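{- Let $G$ be a graph with maximum degree $\Delta(G)\geq 3$. Then $\chi'_{\mathrm{inj}}(G)\leq 2(\Delta(G)-1)^2$.
   Context: All graphs are finite and simple. Three edges $e_1,e_2,e_3$ of a graph are consecutive if they form (in this order) a path of length three or a cycle of length three. An injective edge-coloring of $G$ with $k$ colors is a map $c:E(G)\to\{1,\dots,k\}$ (not necessarily a proper edge-coloring) such that $c(e_1)\neq c(e_3)$ whenever $e_1,e_2,e_3$ are consecutive edges in $G$. The injective chromatic index $\chi'_{\mathrm{inj}}(G)$ is the minimum $k$ such that $G$ has an injective edge-coloring with $k$ colors. -}

module Defs where

open import Data.Empty using (⊥-elim-irr)
open import Data.Fin.Base using (Fin; _<_; finToFun; funToFin)
open import Data.Fin.Properties using (_≟_; _<?_; any?; finToFun-funToFin)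
open import Data.List.Base using (List; []; _∷_; length; map; filter; mapMaybe; cartesianProduct; allFin; lookup)
open import Data.List.Extrema.Nat using (max)
open import Data.List.Membership.Propositional using (_∈_; lose)
open import Data.List.Membership.Propositional.Properties using (∈-allFin; ∈-cartesianProduct⁺)
open import Data.List.Relation.Unary.All as All using (All; all?)
open import Data.List.Relation.Unary.AllPairs using (_∷_)
open import Data.List.Relation.Unary.Any using (index)
open import Data.List.Relation.Unary.Any.Properties using (map⁺; mapMaybe⁺; lookup-index)
open import Data.List.Relation.Unary.Unique.Propositional using (Unique)
open import Data.List.Relation.Unary.Unique.DecPropositional using (unique?)
open import Data.Maybe.Base using (Maybe; just; nothing)
open import Data.Maybe.Relation.Unary.Any as Maybe using ()
open import Data.Nat.Base using (ℕ; zero; suc; z≤n; s≤s; _≤_)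
open import Data.Product.Base using (Σ; ∃; _×_; _,_; proj₁; proj₂)
open import Data.Sum.Base using (_⊎_; inj₁; inj₂)
open import Function.Base using (_∘_)
open import Level using (0ℓ)
open import Relation.Binary.Core using (Rel)
open import Relation.Binary.Definitions using (Decidable; Symmetric; Irreflexive)
open import Relation.Binary.PropositionalEquality using (_≡_; _≢_; refl; sym; trans; cong; subst₂)
open import Relation.Nullary.Decidable using (Dec; yes; no; map′; ¬?; _×-dec_; _⊎-dec_; _→-dec_)
open import Relation.Nullary.Negation using (contradiction)

record Graph (n : ℕ) : Set₁ where
  field
    Adj    : Rel (Fin n) 0ℓ
    adj?   : Decidable Adj
    symm   : Symmetric Adj
    irrefl : Irreflexive _≡_ Adj

module _ {n : ℕ} (G : Graph n) where
  open Graph G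

  degree : Fin n → ℕ
  degree v = length (filter (adj? v) (allFin n))

  -- The value is 0 on the graph without vertices.
  maxDegree : ℕ
  maxDegree = max 0 (map degree (allFin n))

  -- The unordered pair {u , v} is represented by its increasing ordering, and
  -- the proofs are irrelevant, so that two edges with the same ends are equal.
  record Edge : Set where
    constructor edge
    field
      end₁ end₂ : Fin n
      .ordered  : end₁ < end₂
      .adjacent : Adj end₁ end₂

  open Edge

  Joins : Edge → Fin n → Fin n → Set
  Joins e u v = (end₁ e ≡ u × end₂ e ≡ v) ⊎ (end₁ e ≡ v × end₂ e ≡ u)

  data Consecutive (e₁ e₂ e₃ : Edge) : Set where
    path  : ∀ a b c d → Unique (a ∷ b ∷ c ∷ d ∷ []) →
            Joins e₁ a b → Joins e₂ b c → Joins e₃ c d → Consecutive e₁ e₂ e₃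
    cycle : ∀ a b c → Unique (a ∷ b ∷ c ∷ []) →
            Joins e₁ a b → Joins e₂ b c → Joins e₃ c a → Consecutive e₁ e₂ e₃

  IsInjectiveEdgeColoring : ∀ {k} → (Edge → Fin k) → Set
  IsInjectiveEdgeColoring c = ∀ e₁ e₂ e₃ → Consecutive e₁ e₂ e₃ → c e₁ ≢ c e₃

  InjectivelyColorable : ℕ → Set
  InjectivelyColorable k = Σ (Edge → Fin k) IsInjectiveEdgeColoring

IsMinimum : (ℕ → Set) → ℕ → Set
IsMinimum P k = P k × (∀ j → P j → k ≤ j)

minimum : ∀ {P : ℕ → Set} → (∀ k → Dec (P k)) → ∀ m → P m → ∃ (IsMinimum P)
minimum P? zero    p = zero , p , λ _ _ → z≤n
minimum P? (suc m) p with P? zero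
... | yes p₀ = zero , p₀ , λ _ _ → z≤n
... | no ¬p₀ with minimum (P? ∘ suc) m p
...   | k , pk , least = suc k , pk , λ where
        zero    p₀ → contradiction p₀ ¬p₀
        (suc j) pj → s≤s (least j pj)

-- Existence of the minimum in the definition of the injective chromatic index:
-- colorability is decidable by exhaustive search, and a coloring giving all
-- edges distinct colors is injective.
module _ {n : ℕ} (G : Graph n) where
  open Graph G
  private
    E : Set
    E = Edge G
  open Edge

  private
    toEdge : Fin n × Fin n → Maybe E
    toEdge (u , v) with u <? v ×-dec adj? u v
    ... | yes (u<v , uv) = just (edge u v u<v uv)
    ... | no _           = nothing

    toEdge-ends : ∀ e → Maybe.Any (e ≡_) (toEdge (end₁ e , end₂ e))
    toEdge-ends (edge u v u<v uv) with u <? v ×-dec adj? u v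
    ... | yes _ = Maybe.just refl
    ... | no ¬p = ⊥-elim-irr (¬p (u<v , uv))

  edges : List E
  edges = mapMaybe toEdge (cartesianProduct (allFin n) (allFin n))

  ∈-edges : ∀ e → e ∈ edges
  ∈-edges e = mapMaybe⁺ toEdge _
    (map⁺ (lose (∈-cartesianProduct⁺ (∈-allFin (end₁ e)) (∈-allFin (end₂ e))) (toEdge-ends e)))

  edgeIndex : E → Fin (length edges)
  edgeIndex e = index (∈-edges e)

  lookup-edgeIndex : ∀ e → lookup edges (edgeIndex e) ≡ e
  lookup-edgeIndex e = sym (lookup-index (∈-edges e))

  edgeIndex-injective : ∀ {e f} → edgeIndex e ≡ edgeIndex f → e ≡ f
  edgeIndex-injective {e} {f} eq =
    trans (sym (lookup-edgeIndex e)) (trans (cong (lookup edges) eq) (lookup-edgeIndex f))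

  allEdges? : ∀ {P : E → Set} → (∀ e → Dec (P e)) → Dec (∀ e → P e)
  allEdges? P? = map′ (λ ps e → All.lookup ps (∈-edges e)) (λ p → All.universal p edges) (all? P? edges)

  joins? : ∀ e u v → Dec (Joins G e u v)
  joins? e u v = ((end₁ e ≟ u) ×-dec (end₂ e ≟ v)) ⊎-dec ((end₁ e ≟ v) ×-dec (end₂ e ≟ u))

  consecutive? : ∀ e₁ e₂ e₃ → Dec (Consecutive G e₁ e₂ e₃)
  consecutive? e₁ e₂ e₃ = map′
    (λ { (inj₁ (a , b , c , d , u , j₁ , j₂ , j₃)) → path a b c d u j₁ j₂ j₃
       ; (inj₂ (a , b , c , u , j₁ , j₂ , j₃))     → cycle a b c u j₁ j₂ j₃ })
    (λ { (path a b c d u j₁ j₂ j₃) → inj₁ (a , b , c , d , u , j₁ , j₂ , j₃)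
       ; (cycle a b c u j₁ j₂ j₃)  → inj₂ (a , b , c , u , j₁ , j₂ , j₃) })
    ((any? λ a → any? λ b → any? λ c → any? λ d →
        unique? _≟_ (a ∷ b ∷ c ∷ d ∷ []) ×-dec (joins? e₁ a b ×-dec (joins? e₂ b c ×-dec joins? e₃ c d)))
     ⊎-dec
     (any? λ a → any? λ b → any? λ c →
        unique? _≟_ (a ∷ b ∷ c ∷ []) ×-dec (joins? e₁ a b ×-dec (joins? e₂ b c ×-dec joins? e₃ c a))))

  isInjectiveEdgeColoring? : ∀ {k} (c : E → Fin k) → Dec (IsInjectiveEdgeColoring G c)
  isInjectiveEdgeColoring? c = allEdges? λ e₁ → allEdges? λ e₂ → allEdges? λ e₃ →
    consecutive? e₁ e₂ e₃ →-dec ¬? (c e₁ ≟ c e₃)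

  private
    decode : ∀ {k} → Fin _ → E → Fin k
    decode {k} i = finToFun {k} {length edges} i ∘ edgeIndex

    decode-surjective : ∀ {k} (c : E → Fin k) e → decode (funToFin (c ∘ lookup edges)) e ≡ c e
    decode-surjective c e =
      trans (finToFun-funToFin (c ∘ lookup edges) (edgeIndex e)) (cong c (lookup-edgeIndex e))

  injectivelyColorable? : ∀ k → Dec (InjectivelyColorable G k)
  injectivelyColorable? k = map′
    (λ (i , inj) → decode i , inj)
    (λ (c , inj) → funToFin (c ∘ lookup edges) , λ e₁ e₂ e₃ con →
       subst₂ _≢_ (sym (decode-surjective c e₁)) (sym (decode-surjective c e₃)) (inj e₁ e₂ e₃ con))
    (any? λ i → isInjectiveEdgeColoring? (decode {k} i))

  private
    joins-both : ∀ {e a b c d} → Joins G e a b → Joins G e c d → a ≡ c ⊎ a ≡ d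
    joins-both (inj₁ (refl , refl)) (inj₁ (refl , refl)) = inj₁ refl
    joins-both (inj₁ (refl , refl)) (inj₂ (refl , refl)) = inj₂ refl
    joins-both (inj₂ (refl , refl)) (inj₁ (refl , refl)) = inj₂ refl
    joins-both (inj₂ (refl , refl)) (inj₂ (refl , refl)) = inj₁ refl

    joins-swap : ∀ {e a b} → Joins G e a b → Joins G e b a
    joins-swap (inj₁ p) = inj₂ p
    joins-swap (inj₂ p) = inj₁ p

  consecutive⇒≢ : ∀ {e₁ e₂ e₃} → Consecutive G e₁ e₂ e₃ → e₁ ≢ e₃
  consecutive⇒≢ {e₁} (path _ _ _ _ ((_ All.∷ a≢c All.∷ a≢d All.∷ All.[]) ∷ _) j₁ _ j₃) refl
    with joins-both {e₁} j₁ j₃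
  ... | inj₁ a≡c = a≢c a≡c
  ... | inj₂ a≡d = a≢d a≡d
  consecutive⇒≢ {e₁} (cycle _ _ _ ((a≢b All.∷ _) ∷ (b≢c All.∷ All.[]) ∷ _) j₁ _ j₃) refl
    with joins-both {e₁} (joins-swap {e₁} j₁) j₃
  ... | inj₁ b≡c = b≢c b≡c
  ... | inj₂ b≡a = a≢b (sym b≡a)

  edgeIndex-isInjectiveEdgeColoring : IsInjectiveEdgeColoring G edgeIndex
  edgeIndex-isInjectiveEdgeColoring _ _ _ con eq = consecutive⇒≢ con (edgeIndex-injective eq)

  private
    χ′inj-minimum : ∃ (IsMinimum (InjectivelyColorable G))
    χ′inj-minimum =
      minimum injectivelyColorable? (length edges) (edgeIndex , edgeIndex-isInjectiveEdgeColoring)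

  χ′inj : ℕ
  χ′inj = proj₁ χ′inj-minimum

  χ′inj-isMinimum : IsMinimum (InjectivelyColorable G) χ′inj
  χ′inj-isMinimum = proj₂ χ′inj-minimum

{-# OPTIONS --safe #-}
-- Write d = Δ − 1. Each end of an edge starts at most d² non-backtracking walks
-- to a conflicting edge, so the conflicts of an edge occupy at most 2d² slots;
-- with 2d² colors the edge can be colored as soon as one slot is missing,
-- uncolored, or repeats the color of another slot. It therefore suffices to
-- make one uncolored edge uv colored, given any partial coloring. If v lies on
-- a triangle, the slots of uv are redundant. Otherwise the edges at v do not
-- conflict with each other: erase all edges that conflict with them, and give
-- all edges at v the same color. An edge ux with u adjacent to v then sees that
-- color twice and can always be colored, whatever the other colors are. An
-- erased edge further out conflicts with such an edge uw, so it can be colored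
-- after erasing uw, and then uw is colored again. Each step uses a neighbor x of
-- an end of the edge with deg x ≥ 3; if deg x ≤ 2 ≤ d, a slot is missing.
module Submission where

open import Defs
open import Data.Nat.Base using (ℕ; _≤_; _*_; _∸_; _^_)
open import Data.Nat.Base using (suc; z≤n; s≤s; s≤s⁻¹; _<_; _+_)
open import Data.Nat.Properties using (≤-trans; <-≤-trans; ≤-reflexive; <⇒≱; ≮⇒≥; _<?_; +-mono-≤; +-mono-<-≤; +-mono-≤-<; *-monoˡ-≤; *-identityʳ; +-identityʳ; ∸-monoˡ-≤; m≤n+m∸n; m≤m+n; *-mono-≤)
open import Data.Fin.Base using (Fin; fromℕ<)
open import Data.Fin.Properties using (_≟_; any?; ¬∀⟶∃¬; injective⇒≤)
open import Data.List.Base using (List; []; _∷_; _++_; length; map; filter; concatMap; cartesianProduct; allFin; lookup)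
open import Data.List.Extrema.Nat using (xs≤max)
open import Data.List.Membership.Propositional using (_∈_; _∉_; lose)
open import Data.List.Membership.Propositional.Properties
  using (∈-allFin; ∈-cartesianProduct⁺; ∈-filter⁺; ∈-filter⁻; ∈-map⁺; ∈-concatMap⁺; ∈-++⁺ˡ; ∈-++⁺ʳ)
open import Data.List.Properties using (length-map; length-++; filter-notAll)
open import Data.List.Relation.Unary.All as All using (All; []; _∷_)
open import Data.List.Relation.Unary.All.Properties using (all-filter)
open import Data.List.Relation.Unary.AllPairs using (_∷_)
open import Data.List.Relation.Unary.Any using (here; there)
open import Data.List.Relation.Unary.Any.Properties using (lookup-index)
open import Data.List.Relation.Unary.Unique.Propositional using (Unique)
open import Data.List.Relation.Unary.Unique.Propositional.Properties using (allFin⁺; filter⁺)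
import Data.List.Membership.DecPropositional as DecMembership
open import Data.Maybe.Base using (Maybe; just; nothing)
import Data.Maybe.Properties as Maybe
open import Data.Product.Base using (Σ; ∃; _×_; _,_; proj₁; proj₂)
open import Data.Product.Properties using (≡-dec)
open import Data.Sum.Base using (_⊎_; inj₁; inj₂; swap; [_,_]′)
open import Data.Unit.Base using (⊤; tt)
open import Function.Base using (_∘_)
open import Relation.Binary.Definitions using (DecidableEquality)
open import Relation.Binary.PropositionalEquality using (_≡_; _≢_; refl; sym; trans; cong; cong₂; subst; ≢-sym)
open import Relation.Nullary.Decidable using (Dec; yes; no; ¬?; _×-dec_; _⊎-dec_; recompute; toSum)
open import Relation.Nullary.Negation using (¬_; contradiction)

-- Counting in lists, and the pigeonhole principle

module _ {A B : Set} {f : A → List B} {m : ℕ} where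

  length-concatMap-≤ : ∀ xs → (∀ {x} → x ∈ xs → length (f x) ≤ m) →
                       length (concatMap f xs) ≤ length xs * m
  length-concatMap-≤ []       _  = z≤n
  length-concatMap-≤ (x ∷ xs) f≤ rewrite length-++ (f x) {concatMap f xs} =
    +-mono-≤ (f≤ (here refl)) (length-concatMap-≤ xs (f≤ ∘ there))

  length-concatMap-< : ∀ xs → (∀ {x} → x ∈ xs → length (f x) ≤ m) →
                       ∀ {x} → x ∈ xs → length (f x) < m →
                       length (concatMap f xs) < length xs * m
  length-concatMap-< (x ∷ xs) f≤ (here refl)  fx< rewrite length-++ (f x) {concatMap f xs} =
    +-mono-<-≤ fx< (length-concatMap-≤ xs (f≤ ∘ there))
  length-concatMap-< (x ∷ xs) f≤ (there x∈xs) fx< rewrite length-++ (f x) {concatMap f xs} =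
    +-mono-≤-< (f≤ (here refl)) (length-concatMap-< xs (f≤ ∘ there) x∈xs fx<)

-- If every color occurred, the positions of the occurrences would inject `Fin k` into fewer than
-- `k` indices.
missing : ∀ {k} (xs : List (Maybe (Fin k))) → length xs < k → ∃ λ i → just i ∉ xs
missing {k} xs short = ¬∀⟶∃¬ k (λ i → just i ∈ xs) (λ i → just i ∈? xs) λ all →
  <⇒≱ short (injective⇒≤ λ {i} {j} eq → Maybe.just-injective
    (trans (lookup-index (all i)) (trans (cong (lookup xs) eq) (sym (lookup-index (all j))))))
  where open DecMembership (Maybe.≡-dec _≟_) using (_∈?_)

avoid-two : ∀ {A : Set} (_≟′_ : DecidableEquality A) {xs} → Unique xs → 3 ≤ length xs →
            ∀ a b → ∃ λ x → x ∈ xs × x ≢ a × x ≢ b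
avoid-two _≟′_ {x ∷ y ∷ z ∷ _} ((x≢y ∷ x≢z ∷ _) ∷ (y≢z ∷ _) ∷ _) _ a b
  with x ≟′ a | x ≟′ b
... | no x≢a   | no x≢b   = x , here refl , x≢a , x≢b
... | yes refl | _        with y ≟′ b
...   | no y≢b   = y , there (here refl) , ≢-sym x≢y , y≢b
...   | yes refl = z , there (there (here refl)) , ≢-sym x≢z , ≢-sym y≢z
avoid-two _≟′_ {x ∷ y ∷ z ∷ _} ((x≢y ∷ x≢z ∷ _) ∷ (y≢z ∷ _) ∷ _) _ a b
    | no _     | yes refl with y ≟′ a
...   | no y≢a   = y , there (here refl) , y≢a , ≢-sym x≢y
...   | yes refl = z , there (there (here refl)) , ≢-sym y≢z , ≢-sym x≢z
avoid-two _≟′_ {_ ∷ []}     _ (s≤s ())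
avoid-two _≟′_ {_ ∷ _ ∷ []} _ (s≤s (s≤s ()))

-- Conflicting edges as ends of walks

module _ {n : ℕ} (G : Graph n) where
  open Graph G

  -- Two edges conflict exactly when they are the first and the last edge of
  -- such a walk; for a ≡ y it is a triangle.
  record Walk (a b x y : Fin n) : Set where
    constructor walk
    field
      a~b : Adj a b
      b~x : Adj b x
      x~y : Adj x y
      a≢x : a ≢ x
      b≢y : b ≢ y

  reverse : ∀ {a b x y} → Walk a b x y → Walk y x b a
  reverse (walk a~b b~x x~y a≢x b≢y) = walk (symm x~y) (symm b~x) (symm a~b) (≢-sym b≢y) (≢-sym a≢x)

  SameEdge : (a b x y : Fin n) → Set
  SameEdge a b x y = (a ≡ x × b ≡ y) ⊎ (a ≡ y × b ≡ x)

  sameEdge? : ∀ a b x y → Dec (SameEdge a b x y)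
  sameEdge? a b x y = ((a ≟ x) ×-dec (b ≟ y)) ⊎-dec ((a ≟ y) ×-dec (b ≟ x))

  ~⇒≢ : ∀ {a b} → Adj a b → a ≢ b
  ~⇒≢ a~b refl = irrefl refl a~b

  -- Ensures that giving one edge a new color creates no clash of that edge with itself: equal end
  -- edges would contradict `a≢x` or the adjacency `b~x`.
  walk⇒¬sameEdge : ∀ {a b x y p q} → Walk p q x y → SameEdge a b p q → ¬ SameEdge a b x y
  walk⇒¬sameEdge w (inj₁ (refl , refl)) (inj₁ (a≡x , _)) = Walk.a≢x w a≡x
  walk⇒¬sameEdge w (inj₁ (refl , refl)) (inj₂ (_ , refl)) = ~⇒≢ (Walk.b~x w) refl
  walk⇒¬sameEdge w (inj₂ (refl , refl)) (inj₁ (refl , _)) = ~⇒≢ (Walk.b~x w) refl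
  walk⇒¬sameEdge w (inj₂ (refl , refl)) (inj₂ (_ , b≡x)) = Walk.a≢x w b≡x

  -- Neighbors, and slots for conflicting edges

  neighbors : Fin n → List (Fin n)
  neighbors v = filter (adj? v) (allFin n)

  ∈-neighbors : ∀ {v w} → Adj v w → w ∈ neighbors v
  ∈-neighbors {v} {w} = ∈-filter⁺ (adj? v) (∈-allFin w)

  avoid-two-neighbors : ∀ {v} → 3 ≤ degree G v → ∀ a b → ∃ λ w → Adj v w × w ≢ a × w ≢ b
  avoid-two-neighbors {v} big a b
    with w , w∈ , w≢a , w≢b ← avoid-two _≟_ (filter⁺ (adj? v) (allFin⁺ n)) big a b
    = w , proj₂ (∈-filter⁻ (adj? v) {xs = allFin n} w∈) , w≢a , w≢b

  others : Fin n → Fin n → List (Fin n)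
  others v w = filter (λ x → ¬? (x ≟ w)) (neighbors v)

  ∈-others⁺ : ∀ {v w x} → Adj v x → x ≢ w → x ∈ others v w
  ∈-others⁺ {w = w} v~x = ∈-filter⁺ (λ x → ¬? (x ≟ w)) (∈-neighbors v~x)

  ∈-others⁻ : ∀ {v w x} → x ∈ others v w → Adj v x
  ∈-others⁻ {v} {w} x∈ = proj₂ (∈-filter⁻ (adj? v) {xs = allFin n} (proj₁ (∈-filter⁻ (λ x → ¬? (x ≟ w)) {xs = neighbors v} x∈)))

  length-others : ∀ {v w} → Adj v w → length (others v w) < degree G v
  length-others {v} {w} v~w =
    filter-notAll (λ x → ¬? (x ≟ w)) (neighbors v) (lose (∈-neighbors v~w) λ w≢w → w≢w refl)

  -- A conflicting edge {x , y} may be reached from both ends of {a , b}; the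
  -- end b from which it is reached is kept in the triple (b , x , y), so that
  -- it then occupies two slots.
  Slot : Set
  Slot = Fin n × Fin n × Fin n

  continuations : Fin n → Fin n → List Slot
  continuations a b = concatMap (λ x → map (λ y → b , x , y) (others x b)) (others b a)

  slots : Fin n → Fin n → List Slot
  slots a b = continuations a b ++ continuations b a

  ∈-continuations : ∀ {a b x y} → Walk a b x y → (b , x , y) ∈ continuations a b
  ∈-continuations {b = b} (walk _ b~x x~y a≢x b≢y) = ∈-concatMap⁺ (λ x → map (λ y → b , x , y) (others x b))
    (lose (∈-others⁺ b~x (≢-sym a≢x)) (∈-map⁺ _ (∈-others⁺ x~y (≢-sym b≢y))))

  ∈-slotsˡ : ∀ {a b x y} → Walk a b x y → (b , x , y) ∈ slots a b
  ∈-slotsˡ = ∈-++⁺ˡ ∘ ∈-continuations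

  ∈-slotsʳ : ∀ {a b x y} → Walk b a x y → (a , x , y) ∈ slots a b
  ∈-slotsʳ {a} {b} = ∈-++⁺ʳ (continuations a b) ∘ ∈-continuations

  -- Bounds on the number of slots

  module _ {d : ℕ} (degree≤ : ∀ v → degree G v ≤ suc d) where

    private
      length-others-≤ : ∀ {v w} → Adj v w → length (others v w) ≤ d
      length-others-≤ {v} v~w = s≤s⁻¹ (≤-trans (length-others v~w) (degree≤ v))

      length-branch-≤ : ∀ {a b x} → x ∈ others b a → length (map (λ y → b , x , y) (others x b)) ≤ d
      length-branch-≤ {a} {b} {x} x∈ rewrite length-map (λ y → b , x , y) (others x b) =
        length-others-≤ (symm (∈-others⁻ x∈))

    length-continuations-≤ : ∀ {a b} → Adj a b → length (continuations a b) ≤ d * d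
    length-continuations-≤ {a} {b} a~b =
      ≤-trans (length-concatMap-≤ (others b a) length-branch-≤)
              (*-monoˡ-≤ d (length-others-≤ (symm a~b)))

    -- As `b` is among the at most `d` neighbors of `x`, fewer than `d` walks continue through `x`;
    -- this one short branch makes the total strict.
    length-continuations-< : ∀ {a b x} → Adj a b → Adj b x → x ≢ a → degree G x ≤ d →
                             length (continuations a b) < d * d
    length-continuations-< {a} {b} {x} a~b b~x x≢a x≤d =
      <-≤-trans
        (length-concatMap-< (others b a) length-branch-≤ (∈-others⁺ b~x x≢a)
          (subst (_< d) (sym (length-map (λ y → b , x , y) (others x b)))
            (<-≤-trans (length-others (symm b~x)) x≤d)))
        (*-monoˡ-≤ d (length-others-≤ (symm a~b)))

    length-slots-≤ : ∀ {a b} → Adj a b → length (slots a b) ≤ d * d + d * d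
    length-slots-≤ {a} {b} a~b rewrite length-++ (continuations a b) {continuations b a} =
      +-mono-≤ (length-continuations-≤ a~b) (length-continuations-≤ (symm a~b))

    length-slots-< : ∀ {a b x} → Adj a b → Adj b x → x ≢ a → degree G x ≤ d →
                     length (slots a b) < d * d + d * d
    length-slots-< {a} {b} a~b b~x x≢a x≤d rewrite length-++ (continuations a b) {continuations b a} =
      +-mono-<-≤ (length-continuations-< a~b b~x x≢a x≤d) (length-continuations-≤ (symm a~b))

  -- Partial colorings and recoloring a single edge

  module _ {k : ℕ} where

    -- Colors live on ordered pairs of vertices, adjacent or not; only edges are constrained, since
    -- a `Walk` includes the adjacencies. The value `nothing` means uncolored.
    record PartialColoring : Set where
      field
        color     : Fin n → Fin n → Maybe (Fin k)
        color-sym : ∀ a b → color a b ≡ color b a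
        valid     : ∀ {a b x y i} → Walk a b x y → color a b ≡ just i → color x y ≢ just i

    open PartialColoring public

    Colored : PartialColoring → Fin n → Fin n → Set
    Colored c a b = ∃ λ i → color c a b ≡ just i

    infix 4 _⊑_
    -- Restricted to adjacent pairs, because erasing around a vertex also clears nonadjacent pairs,
    -- which are not filled again.
    _⊑_ : PartialColoring → PartialColoring → Set
    c ⊑ c′ = ∀ {a b} → Adj a b → Colored c a b → Colored c′ a b

    Free : PartialColoring → Fin n → Fin n → Fin k → Set
    Free c a b i = ∀ {x y} → Walk a b x y ⊎ Walk b a x y → color c x y ≢ just i

    Fillable : PartialColoring → Fin n → Fin n → Set
    Fillable c a b = ∃ (Free c a b)

    fillable-sym : ∀ {c a b} → Fillable c a b → Fillable c b a
    fillable-sym (i , free) = i , free ∘ swap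

    colorEmpty : PartialColoring
    colorEmpty = record { color = λ _ _ → nothing ; color-sym = λ _ _ → refl ; valid = λ _ () }

    module _ (c : PartialColoring) (a b : Fin n) (m : Maybe (Fin k))
             (free : ∀ {i} → m ≡ just i → Free c a b i) where

      private
        color′ : Fin n → Fin n → Maybe (Fin k)
        color′ x y with sameEdge? a b x y
        ... | yes _ = m
        ... | no _  = color c x y

        at : ∀ {x y} → SameEdge a b x y → color′ x y ≡ m
        at {x} {y} same with sameEdge? a b x y
        ... | yes _    = refl
        ... | no ¬same = contradiction same ¬same

        off : ∀ {x y} → ¬ SameEdge a b x y → color′ x y ≡ color c x y
        off {x} {y} ¬same with sameEdge? a b x y
        ... | yes same = contradiction same ¬same
        ... | no _     = refl

        color′-sym : ∀ x y → color′ x y ≡ color′ y x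
        color′-sym x y with sameEdge? a b x y
        ... | yes same = sym (at (swap same))
        ... | no ¬same = trans (color-sym c x y) (sym (off (¬same ∘ swap)))

        oriented : ∀ {p q x y} → Walk p q x y → SameEdge a b p q → Walk a b x y ⊎ Walk b a x y
        oriented w (inj₁ (refl , refl)) = inj₁ w
        oriented w (inj₂ (refl , refl)) = inj₂ w

        valid′ : ∀ {p q x y i} → Walk p q x y → color′ p q ≡ just i → color′ x y ≢ just i
        valid′ {p} {q} {x} {y} w with sameEdge? a b p q | sameEdge? a b x y
        ... | yes s | yes t = contradiction t (walk⇒¬sameEdge w s)
        ... | no _  | no _  = valid c w
        ... | yes s | no _  = λ m≡i → free m≡i (oriented w s)
        -- The recolored edge comes last here, so the walk is read backwards to apply `free`.
        ... | no _  | yes t = λ pq≡i m≡i →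
          free m≡i (oriented (reverse w) (swap t)) (trans (color-sym c q p) pq≡i)

      -- Serves both erasing and filling: for `m` equal to `nothing` the condition `free` is
      -- vacuous.
      assign : PartialColoring
      assign = record { color = color′ ; color-sym = color′-sym ; valid = valid′ }

      assign-at : ∀ {x y} → SameEdge a b x y → color assign x y ≡ m
      assign-at = at

      assign-off : ∀ {x y} → ¬ SameEdge a b x y → color assign x y ≡ color c x y
      assign-off = off

    colored-sym : ∀ {c a b} → Colored c a b → Colored c b a
    colored-sym {c} {a} {b} (i , eq) = i , trans (color-sym c b a) eq

    -- The new coloring may have other colors than c on the edges colored by c.
    record Extension (c : PartialColoring) (a b : Fin n) : Set where
      field
        extended : PartialColoring
        extends  : c ⊑ extended
        colored  : Colored extended a b

    open Extension public

    erase : PartialColoring → Fin n → Fin n → PartialColoring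
    erase c a b = assign c a b nothing λ ()

    module _ {c : PartialColoring} {a b : Fin n} (fillable : Fillable c a b) where

      private
        free′ : ∀ {i} → just (proj₁ fillable) ≡ just i → Free c a b i
        free′ refl = proj₂ fillable

      fill : PartialColoring
      fill = assign c a b (just (proj₁ fillable)) free′

      fill-at : ∀ {x y} → SameEdge a b x y → Colored fill x y
      fill-at same = _ , assign-at c a b _ free′ same

      fill-off : ∀ {x y} → ¬ SameEdge a b x y → color fill x y ≡ color c x y
      fill-off = assign-off c a b _ free′

      fill-⊑ : ∀ {x y} → Colored c x y → Colored fill x y
      fill-⊑ {x} {y} (i , eq) = [ fill-at , (λ ¬same → i , trans (fill-off ¬same) eq) ]′
        (toSum (sameEdge? a b x y))

    -- Free colors from counting slots

    colorSlot : PartialColoring → Slot → Maybe (Fin k)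
    colorSlot c (_ , x , y) = color c x y

    private
      _≟ₛ_ : DecidableEquality Slot
      _≟ₛ_ = ≡-dec _≟_ (≡-dec _≟_ _≟_)

    missing-slots : ∀ c (ss : List Slot) → length ss < k → ∃ λ i → ∀ {s} → s ∈ ss → colorSlot c s ≢ just i
    missing-slots c ss short
      with i , i∉ ← missing (map (colorSlot c) ss) (subst (_< k) (sym (length-map (colorSlot c) ss)) short)
      = i , λ s∈ eq → i∉ (subst (_∈ map (colorSlot c) ss) eq (∈-map⁺ (colorSlot c) s∈))

    fillable-slots : ∀ {c a b i} → (∀ {s} → s ∈ slots a b → colorSlot c s ≢ just i) → Fillable c a b
    fillable-slots {i = i} unused = i , [ unused ∘ ∈-slotsˡ , unused ∘ ∈-slotsʳ ]′

    fillable-short : ∀ {c a b} → length (slots a b) < k → Fillable c a b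
    fillable-short {c} {a} {b} short with i , unused ← missing-slots c (slots a b) short =
      fillable-slots {c} unused

    module _ {c : PartialColoring} {a b : Fin n} (short : length (slots a b) ≤ k)
             {s : Slot} (s∈ : s ∈ slots a b) where

      private
        ≢s? : ∀ t → Dec (t ≢ s)
        ≢s? t = ¬? (t ≟ₛ s)

        rest : List Slot
        rest = filter ≢s? (slots a b)

        rest-short : length rest < k
        rest-short = <-≤-trans (filter-notAll ≢s? (slots a b) (lose s∈ λ s≢s → s≢s refl)) short

        unused-in-rest : ∃ λ i → ∀ {t} → t ∈ rest → colorSlot c t ≢ just i
        unused-in-rest = missing-slots c rest rest-short

      -- Without `s` there are fewer than `k` slots, so some color is missing from the rest; `s`
      -- cannot carry it either, since `copy` would show it on another slot. An uncolored `s`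
      -- satisfies the hypothesis vacuously.
      fillable-redundant : (∀ {i} → colorSlot c s ≡ just i → ∃ λ t → t ∈ slots a b × t ≢ s × colorSlot c t ≡ just i) →
                           Fillable c a b
      fillable-redundant copy with i , unused ← unused-in-rest = fillable-slots {c} unused′
        where
        unused′ : ∀ {t} → t ∈ slots a b → colorSlot c t ≢ just i
        unused′ {t} t∈ eq with t ≟ₛ s
        ... | no t≢s = unused (∈-filter⁺ ≢s? t∈ t≢s) eq
        ... | yes refl with u , u∈ , u≢s , eq′ ← copy eq = unused (∈-filter⁺ ≢s? u∈ u≢s) eq′

    -- Later steps may change colors but leave no colored edge uncolored, so the pairs already
    -- treated stay colored. What must hold of the actual colors is carried by `Inv`.
    extendAll : ∀ (Inv : PartialColoring → Set) {Q : Fin n × Fin n → Set} →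
                (∀ c → Inv c → ∀ {a b} → Q (a , b) → Σ (Extension c a b) (Inv ∘ extended)) →
                ∀ {ps} → All Q ps → ∀ c → Inv c →
                ∃ λ c′ → Inv c′ × c ⊑ c′ × (∀ {a b} → Adj a b → (a , b) ∈ ps → Colored c′ a b)
    extendAll Inv step []       c inv = c , inv , (λ _ col → col) , λ _ ()
    extendAll Inv step (q ∷ qs) c inv
      with e , inv₁ ← step c inv q
      with c′ , inv′ , c₁⊑c′ , all ← extendAll Inv step qs (extended e) inv₁
      = c′ , inv′ , (λ a~b → c₁⊑c′ a~b ∘ extends e a~b) , λ where
          a~b (here refl) → c₁⊑c′ a~b (colored e)
          a~b (there p∈)  → all a~b p∈

    -- Fillable edges under the degree bound

    module _ {d : ℕ} (2≤d : 2 ≤ d) (degree≤ : ∀ v → degree G v ≤ suc d) (room : d * d + d * d ≤ k) (i₀ : Fin k) where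

      private
        slots-short : ∀ {a b} → Adj a b → length (slots a b) ≤ k
        slots-short a~b = ≤-trans (length-slots-≤ degree≤ a~b) room

      -- Lets each later argument assume that `x` has a neighbor outside any two given vertices.
      fillable-or-big : ∀ c {a b x} → Adj a b → Adj b x → x ≢ a → Fillable c a b ⊎ 3 ≤ degree G x
      fillable-or-big c {x = x} a~b b~x x≢a with degree G x <? 3
      ... | no x≮3  = inj₂ (≮⇒≥ x≮3)
      ... | yes x<3 = inj₁ (fillable-short {c}
        (<-≤-trans (length-slots-< degree≤ a~b b~x x≢a (≤-trans (s≤s⁻¹ x<3) 2≤d)) room))

      fillable-uncolored : ∀ {c a b x y} → Walk a b x y → color c x y ≡ nothing → Fillable c a b
      fillable-uncolored {c} w eq = fillable-redundant {c} (slots-short (Walk.a~b w)) (∈-slotsˡ w)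
        λ eq′ → contradiction (trans (sym eq) eq′) λ ()

      -- For a third neighbor `z` of `x`, the edge `xz` is reached from `b` and from `a`, hence
      -- fills two slots of `ab` with one color.
      fillable-triangle : ∀ c {a b x} → Adj a b → Adj b x → Adj a x → Fillable c a b
      fillable-triangle c {a} {b} {x} a~b b~x a~x with fillable-or-big c a~b b~x (≢-sym (~⇒≢ a~x))
      ... | inj₁ fillable = fillable
      ... | inj₂ big with z , x~z , z≢a , z≢b ← avoid-two-neighbors big a b =
        fillable-redundant {c} (slots-short a~b)
          (∈-slotsˡ (walk a~b b~x x~z (~⇒≢ a~x) (≢-sym z≢b)))
          λ eq → _ , ∈-slotsʳ (walk (symm a~b) a~x x~z (~⇒≢ b~x) (≢-sym z≢a)) , ~⇒≢ a~b ∘ cong proj₁ , eq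

      -- The edge `xy` opposite to `v` is reached through `x` and through `y`, hence fills two slots
      -- with one color. If `x` or `y` is `u`, then `uv` itself lies on the triangle.
      fillable-near-triangle : ∀ c {u v x y} → Adj u v → Adj v x → Adj v y → Adj x y → Fillable c u v
      fillable-near-triangle c {u} {v} {x} {y} u~v v~x v~y x~y with x ≟ u | y ≟ u
      ... | yes refl | _        = fillable-triangle c u~v v~y x~y
      ... | no _     | yes refl = fillable-triangle c u~v v~x (symm x~y)
      ... | no x≢u   | no y≢u   = fillable-redundant {c} (slots-short u~v)
        (∈-slotsˡ (walk u~v v~x x~y (≢-sym x≢u) (~⇒≢ v~y)))
        λ eq → _ , ∈-slotsˡ (walk u~v v~y (symm x~y) (≢-sym y≢u) (~⇒≢ v~x)) ,
               ~⇒≢ x~y ∘ sym ∘ cong (proj₁ ∘ proj₂) , trans (color-sym c y x) eq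

      -- Recoloring around a vertex on no triangle

      module Star (v : Fin n) (independent : ∀ {x y} → Adj v x → Adj v y → ¬ Adj x y) where

        StarColored : PartialColoring → Set
        StarColored c = ∀ {w} → Adj v w → color c v w ≡ just i₀

        fillable-incident : ∀ c → StarColored c → ∀ {u x} → Adj v u → Adj u x → x ≢ v → Fillable c x u
        fillable-incident c star {u} {x} v~u u~x x≢v with fillable-or-big c (symm u~x) (symm v~u) (≢-sym x≢v)
        ... | inj₁ fillable = fillable
        -- Here `big` concerns the degree of `v`, so `v` has two neighbors `w` and `w′` besides `u`;
        -- the edges to them fill two slots with the color `i₀`.
        ... | inj₂ big
          with w  , v~w  , w≢u  , _     ← avoid-two-neighbors big u u
          with w′ , v~w′ , w′≢u , w′≢w ← avoid-two-neighbors big u w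
          = fillable-redundant {c} (slots-short (symm u~x))
              (∈-slotsˡ (walk (symm u~x) (symm v~u) v~w x≢v (≢-sym w≢u)))
              λ eq → _ , ∈-slotsˡ (walk (symm u~x) (symm v~u) v~w′ x≢v (≢-sym w′≢u)) ,
                     w′≢w ∘ cong (proj₂ ∘ proj₂) , trans (star v~w′) (trans (sym (star v~w)) eq)

        fill-star : ∀ {c a b} (fillable : Fillable c a b) → a ≢ v → b ≢ v → StarColored c → StarColored (fill {c} fillable)
        fill-star {c} fillable a≢v b≢v star v~w = trans
          (fill-off {c} fillable λ { (inj₁ (a≡v , _)) → a≢v a≡v ; (inj₂ (_ , b≡v)) → b≢v b≡v }) (star v~w)

        extend-fill : ∀ {c a b} → Fillable c a b → a ≢ v → b ≢ v → StarColored c → Σ (Extension c a b) (StarColored ∘ extended)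
        extend-fill {c} fillable a≢v b≢v star =
          record { extended = fill {c} fillable
                 ; extends  = λ _ → fill-⊑ {c} fillable
                 ; colored  = fill-at {c} fillable (inj₁ (refl , refl)) } ,
          fill-star {c} fillable a≢v b≢v star

        -- An edge at distance two from v is filled after erasing an edge at
        -- a neighbor of v, which can always be filled again.
        extend-near : ∀ c → StarColored c → ∀ {a u b} → Adj v u → Adj u b → Adj a b → a ≢ v → b ≢ v →
                      Σ (Extension c a b) (StarColored ∘ extended)
        extend-near c star {a} {u} {b} v~u u~b a~b a≢v b≢v with u ≟ a
        -- The end `a` is itself adjacent to `v`, so the edge can be filled at once.
        ... | yes refl = extend-fill {c} (fillable-sym {c} (fillable-incident c star v~u u~b b≢v)) a≢v b≢v star
        ... | no u≢a with fillable-or-big c a~b (symm u~b) u≢a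
        ...   | inj₁ fillable = extend-fill {c} fillable a≢v b≢v star
        -- That `w` is not `b` makes `a`, `b`, `u`, `w` a walk, and that it is not `v` keeps the
        -- star intact when `wu` is erased; `w` may equal `a`.
        ...   | inj₂ big with w , u~w , w≢v , w≢b ← avoid-two-neighbors big v b = result
          where
          u≢v : u ≢ v
          u≢v = ≢-sym (~⇒≢ v~u)

          c₁ : PartialColoring
          c₁ = erase c w u

          star₁ : StarColored c₁
          star₁ v~x = trans (assign-off c w u nothing (λ ())
            λ { (inj₁ (w≡v , _)) → w≢v w≡v ; (inj₂ (_ , u≡v)) → u≢v u≡v }) (star v~x)

          fillable₁ : Fillable c₁ a b
          fillable₁ = fillable-uncolored {c₁} (walk a~b (symm u~b) u~w (≢-sym u≢a) (≢-sym w≢b))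
            (assign-at c w u nothing (λ ()) (inj₂ (refl , refl)))

          c₂ : PartialColoring
          c₂ = fill {c₁} fillable₁

          star₂ : StarColored c₂
          star₂ = fill-star {c₁} fillable₁ a≢v b≢v star₁

          fillable₂ : Fillable c₂ w u
          fillable₂ = fillable-incident c₂ star₂ v~u u~w w≢v

          extends₃ : ∀ {x y} → Colored c x y → Colored (fill {c₂} fillable₂) x y
          extends₃ {x} {y} (i , eq) =
            [ fill-at {c₂} fillable₂
            , (λ ¬same → fill-⊑ {c₂} fillable₂ (fill-⊑ {c₁} fillable₁
                (i , trans (assign-off c w u nothing (λ ()) ¬same) eq)))
            ]′ (toSum (sameEdge? w u x y))

          result : Σ (Extension c a b) (StarColored ∘ extended)
          result =
            record { extended = fill {c₂} fillable₂
                   ; extends  = λ _ → extends₃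
                   ; colored  = fill-⊑ {c₂} fillable₂ (fill-at {c₁} fillable₁ (inj₁ (refl , refl))) } ,
            fill-star {c₂} fillable₂ w≢v u≢v star₂

        -- The ends of walks of length two from `v`; thus `v` itself is included as soon as it has a
        -- neighbor.
        Near : Fin n → Set
        Near x = ∃ λ u → Adj v u × Adj u x

        near? : ∀ x → Dec (Near x)
        near? x = any? λ u → adj? v u ×-dec adj? u x

        AtCenter NearEdge : Fin n → Fin n → Set
        AtCenter a b = a ≡ v ⊎ b ≡ v
        NearEdge a b = Near a ⊎ Near b

        atCenter? : ∀ a b → Dec (AtCenter a b)
        atCenter? a b = (a ≟ v) ⊎-dec (b ≟ v)

        nearEdge? : ∀ a b → Dec (NearEdge a b)
        nearEdge? a b = near? a ⊎-dec near? b

        -- The center is tested first, since an edge at `v` is also a `NearEdge`.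
        starColor : PartialColoring → Fin n → Fin n → Maybe (Fin k)
        starColor c a b with atCenter? a b | nearEdge? a b
        ... | yes _ | _     = just i₀
        ... | no _  | yes _ = nothing
        ... | no _  | no _  = color c a b

        walk-at-center : ∀ {a b x y} → Walk a b x y → AtCenter a b → ¬ AtCenter x y
        walk-at-center w (inj₁ refl) (inj₁ refl) = Walk.a≢x w refl
        -- The walk closes to a triangle through `v`, which `independent` excludes.
        walk-at-center w (inj₁ refl) (inj₂ refl) = independent (Walk.a~b w) (symm (Walk.x~y w)) (Walk.b~x w)
        walk-at-center w (inj₂ refl) (inj₁ refl) = ~⇒≢ (Walk.b~x w) refl
        walk-at-center w (inj₂ refl) (inj₂ refl) = Walk.b≢y w refl

        -- Guarantees that clearing the near edges off the center clears every conflict with the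
        -- star.
        walk-from-center : ∀ {a b x y} → Walk a b x y → AtCenter a b → NearEdge x y
        walk-from-center w (inj₁ refl) = inj₁ (_ , Walk.a~b w , Walk.b~x w)
        walk-from-center w (inj₂ refl) = inj₂ (_ , Walk.b~x w , Walk.x~y w)

        starColor-sym : ∀ c a b → starColor c a b ≡ starColor c b a
        starColor-sym c a b
          with atCenter? a b | nearEdge? a b | atCenter? b a | nearEdge? b a
        ... | yes _ | _     | yes _ | _     = refl
        ... | yes p | _     | no ¬p | _     = contradiction (swap p) ¬p
        ... | no ¬p | _     | yes p | _     = contradiction (swap p) ¬p
        ... | no _  | yes _ | no _  | yes _ = refl
        ... | no _  | yes p | no _  | no ¬p = contradiction (swap p) ¬p
        ... | no _  | no ¬p | no _  | yes p = contradiction (swap p) ¬p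
        ... | no _  | no _  | no _  | no _  = color-sym c a b

        starColor-valid : ∀ c {a b x y i} → Walk a b x y → starColor c a b ≡ just i → starColor c x y ≢ just i
        starColor-valid c {a} {b} {x} {y} w
          with atCenter? a b | nearEdge? a b | atCenter? x y | nearEdge? x y
        ... | yes p | _     | yes q | _     = contradiction q (walk-at-center w p)
        ... | yes _ | _     | no _  | yes _ = λ _ ()
        ... | yes p | _     | no _  | no ¬q = contradiction (walk-from-center w p) ¬q
        ... | no _  | yes _ | _     | _     = λ ()
        ... | no _  | no ¬p | yes q | _     = contradiction (swap (walk-from-center (reverse w) (swap q))) ¬p
        ... | no _  | no _  | no _  | yes _ = λ _ ()
        ... | no _  | no _  | no _  | no _  = valid c w

        colorStar : PartialColoring → PartialColoring
        colorStar c = record { color = starColor c ; color-sym = starColor-sym c ; valid = starColor-valid c }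

        colorStar-center : ∀ c {a b} → AtCenter a b → color (colorStar c) a b ≡ just i₀
        colorStar-center c {a} {b} p with atCenter? a b
        ... | yes _ = refl
        ... | no ¬p = contradiction p ¬p

        colorStar-far : ∀ c {a b} → ¬ NearEdge a b → Colored c a b → Colored (colorStar c) a b
        colorStar-far c {a} {b} ¬p col with atCenter? a b | nearEdge? a b
        ... | yes _ | _     = i₀ , refl
        ... | no _  | yes p = contradiction p ¬p
        ... | no _  | no _  = col

        ToRefill : Fin n × Fin n → Set
        ToRefill (a , b) = Adj a b × a ≢ v × b ≢ v × NearEdge a b

        toRefill? : ∀ p → Dec (ToRefill p)
        toRefill? (a , b) = adj? a b ×-dec (¬? (a ≟ v) ×-dec (¬? (b ≟ v) ×-dec nearEdge? a b))

        refill : ∀ c → StarColored c → ∀ {a b} → ToRefill (a , b) → Σ (Extension c a b) (StarColored ∘ extended)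
        refill c star (a~b , a≢v , b≢v , inj₂ (u , v~u , u~b)) = extend-near c star v~u u~b a~b a≢v b≢v
        refill c star (a~b , a≢v , b≢v , inj₁ (u , v~u , u~a))
          with e , star′ ← extend-near c star v~u u~a (symm a~b) b≢v a≢v
          = record { extended = extended e
                   ; extends  = extends e
                   ; colored  = colored-sym {extended e} (colored e) } , star′

        -- The list of ordered pairs contains each near edge off the center in both orders, colored
        -- before or not; the second filling leaves no colored edge uncolored.
        extend-star : ∀ c {u} → Adj u v → Extension c u v
        extend-star c {u} u~v
          with c′ , star , c₁⊑c′ , refilled ←
            extendAll StarColored refill
              (all-filter toRefill? (cartesianProduct (allFin n) (allFin n)))
              (colorStar c) (λ _ → colorStar-center c (inj₁ refl))
          = record { extended = c′
                   ; extends  = c⊑c′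
                   ; colored  = i₀ , trans (color-sym c′ u v) (star (symm u~v)) }
          where
          c⊑c′ : c ⊑ c′
          -- Edges at `v` are colored by the star, far edges keep a color, and the rest are
          -- refilled.
          c⊑c′ {a} {b} a~b col with atCenter? a b | nearEdge? a b
          ... | yes p | _     = c₁⊑c′ a~b (i₀ , colorStar-center c p)
          ... | no _  | no ¬p = c₁⊑c′ a~b (colorStar-far c ¬p col)
          ... | no ¬p | yes q = refilled a~b (∈-filter⁺ toRefill?
            (∈-cartesianProduct⁺ (∈-allFin a) (∈-allFin b)) (a~b , ¬p ∘ inj₁ , ¬p ∘ inj₂ , q))

      -- Extension to one more edge, and to all edges

      extend : ∀ c {u v} → Adj u v → Extension c u v
      extend c {u} {v} u~v with (any? λ x → any? λ y → adj? v x ×-dec (adj? v y ×-dec adj? x y))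
      ... | no ¬triangle = Star.extend-star v (λ v~x v~y x~y → ¬triangle (_ , _ , v~x , v~y , x~y)) c u~v
      ... | yes (_ , _ , v~x , v~y , x~y) =
        record { extended = fill {c} fillable
               ; extends  = λ _ → fill-⊑ {c} fillable
               ; colored  = fill-at {c} fillable (inj₁ (refl , refl)) }
        where
        fillable : Fillable c u v
        fillable = fillable-near-triangle c u~v v~x v~y x~y

      total-coloring : ∃ λ c → ∀ {a b} → Adj a b → Colored c a b
      total-coloring
        with c , _ , _ , all ← extendAll (λ _ → ⊤) {λ (a , b) → Adj a b} (λ c _ a~b → extend c a~b , tt)
               (all-filter (λ (a , b) → adj? a b) (cartesianProduct (allFin n) (allFin n))) colorEmpty tt
        = c , λ {a} {b} a~b → all a~b (∈-filter⁺ (λ (a , b) → adj? a b)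
                (∈-cartesianProduct⁺ (∈-allFin a) (∈-allFin b)) a~b)

    -- From a total coloring to an injective edge coloring

    total⇒injectivelyColorable : ∀ c → (∀ {a b} → Adj a b → Colored c a b) → InjectivelyColorable G k
    total⇒injectivelyColorable c total = edgeColor , λ where
        e₁ e₂ e₃ (path a b x y ((_ ∷ a≢x ∷ _) ∷ (_ ∷ b≢y ∷ _) ∷ _) j₁ j₂ j₃) →
          differ {e₁} {e₃} j₁ j₃ (walk (joins-adj {e₁} j₁) (joins-adj {e₂} j₂) (joins-adj {e₃} j₃) a≢x b≢y)
        -- A triangle is the walk `a`, `b`, `x`, `a`.
        e₁ e₂ e₃ (cycle a b x ((a≢b ∷ a≢x ∷ _) ∷ _) j₁ j₂ j₃) →
          differ {e₁} {e₃} j₁ j₃ (walk (joins-adj {e₁} j₁) (joins-adj {e₂} j₂) (joins-adj {e₃} j₃) a≢x (≢-sym a≢b))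
      where
      ends-adj : (e : Edge G) → Adj (Edge.end₁ e) (Edge.end₂ e)
      -- The adjacency stored in an edge is irrelevant; decidability of `Adj` recovers a usable
      -- proof.
      ends-adj (edge u v _ u~v) = recompute (adj? u v) u~v

      edgeColor : Edge G → Fin k
      edgeColor e = proj₁ (total (ends-adj e))

      joins-adj : ∀ {e a b} → Joins G e a b → Adj a b
      joins-adj {e} (inj₁ (refl , refl)) = ends-adj e
      joins-adj {e} (inj₂ (refl , refl)) = symm (ends-adj e)

      joins-color : ∀ {e a b} → Joins G e a b → color c a b ≡ just (edgeColor e)
      joins-color {e} (inj₁ (refl , refl)) = proj₂ (total (ends-adj e))
      joins-color {e} (inj₂ (refl , refl)) = trans (color-sym c _ _) (proj₂ (total (ends-adj e)))

      differ : ∀ {e f a b x y} → Joins G e a b → Joins G f x y → Walk a b x y → edgeColor e ≢ edgeColor f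
      differ {e} {f} j j′ w eq = valid c w (joins-color {e} j) (trans (joins-color {f} j′) (cong just (sym eq)))

-- The bound in terms of the maximum degree

degree≤maxDegree : ∀ {n} (G : Graph n) v → degree G v ≤ maxDegree G
degree≤maxDegree {n} G v =
  All.lookup (xs≤max 0 (map (degree G) (allFin n))) (∈-map⁺ (degree G) (∈-allFin v))

theorem1p9 : ∀ {n : ℕ} (G : Graph n) → 3 ≤ maxDegree G → χ′inj G ≤ 2 * (maxDegree G ∸ 1) ^ 2
theorem1p9 G 3≤Δ =
  -- The star color `i₀` is color zero, which exists because the palette is nonempty.
  let c , total = total-coloring G 2≤d degree≤ (≤-reflexive room) (fromℕ< positive)
  in proj₂ (χ′inj-isMinimum G) _ (total⇒injectivelyColorable G c total)
  where
  d : ℕ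
  d = maxDegree G ∸ 1

  2≤d : 2 ≤ d
  2≤d = ∸-monoˡ-≤ 1 3≤Δ

  degree≤ : ∀ v → degree G v ≤ suc d
  degree≤ v = ≤-trans (degree≤maxDegree G v) (m≤n+m∸n (maxDegree G) 1)

  room : d * d + d * d ≡ 2 * d ^ 2
  -- The right side unfolds to `d * (d * 1) + (d * (d * 1) + 0)`.
  room = cong₂ _+_ (cong (d *_) (sym (*-identityʳ d)))
    (trans (cong (d *_) (sym (*-identityʳ d))) (sym (+-identityʳ _)))

  positive : 0 < 2 * d ^ 2
  positive = subst (0 <_) room
    (≤-trans (s≤s z≤n) (≤-trans (*-mono-≤ 2≤d 2≤d) (m≤m+n (d * d) (d * d))))
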